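{- A graph $G$ satisfies $G\in Forb\{K_{1,3},\overline{K_{1,3}}\}$ (that is, neither $K_{1,3}$ nor its complement $\overline{K_{1,3}}$ is isomorphic to an induced subgraph of $G$) if and only if $G$ or its complement $\overline G$ is one of the following: (a) a graph isomorphic to $A_6$; (b) a graph isomorphic to an induced subgraph of $P_9$; (c) a graph each of whose connected components is a cycle of length at least $4$, a path, or an isolated vertex.
   Context: Graphs are undirected, simple and loopless: a graph is a pair $(V,\mathcal E)$ with $\mathcal E\subseteq [V]^2$, the set of $2$-element subsets of $V$. No finiteness of $V$ is required; if $V$ is infinite, a connected component that is a path may be a finite, one-way infinite or two-way infinite path. The complement of $G=(V,\mathcal E)$ is $\overline G=(V,[V]^2\setminus\mathcal E)$. For a set $\mathcal F$ of graphs, $Forb\,\mathcal F$ is the class of graphs $G$ such that no member of $\mathcal F$ is isomorphic to an induced subgraph of $G$. $K_{1,3}$ (the claw) is the graph on $4$ vertices made of one vertex adjacent to three pairwise nonadjacent vertices. $A_6$ is the graph on $6$ vertices made of a triangle $K_3$ bounded by three triangles: vertices $a,b,c,a',b',c'$, where $a,b,c$ are pairwise adjacent, $a'$ is adjacent exactly to $b,c$, $b'$ exactly to $a,c$, and $c'$ exactly to $a,b$ (nine edges in all). $P_9$ is the Paley graph on $9$ vertices, isomorphic to the cartesian product $K_3\Box K_3$: its vertices are the pairs $(i,j)$ with $i,j\in\{0,1,2\}$, two distinct pairs being adjacent iff they agree in exactly one coordinate. -}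

module Defs where

open import Level using (Level; 0ℓ; suc; _⊔_)
open import Data.Empty using (⊥)
open import Data.Fin.Base using (Fin; toℕ)
import Data.Integer.Base as ℤ
open import Data.Nat.Base as ℕ using (ℕ; _≤_)
open import Data.Product.Base using (Σ-syntax; ∃-syntax; _×_; _,_)
open import Data.Refinement.Base using (Refinement; value)
open import Data.Sum.Base using (_⊎_; inj₁; inj₂)
open import Function.Bundles using (_↔_; _⇔_; Inverse)
open import Relation.Binary.Core using (Rel)
open import Relation.Binary.Construct.Closure.ReflexiveTransitive using (Star)
open import Relation.Binary.Construct.Closure.Symmetric using (SymClosure; symmetric)
open import Relation.Binary.Definitions using (Irreflexive; Symmetric)
open import Relation.Binary.PropositionalEquality using (_≡_; _≢_; refl; sym; ≢-sym)
open import Relation.Nullary.Negation using (¬_)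
open import Relation.Unary using (Pred; _∈_)

private
  variable
    v e v′ e′ p ℓ r : Level

record Graph (v e : Level) : Set (suc (v ⊔ e)) where
  field
    V        : Set v
    _~_      : Rel V e
    ~-irrefl : Irreflexive _≡_ _~_
    ~-sym    : Symmetric _~_

open Graph using (V)

complement : Graph v e → Graph v (v ⊔ e)
complement G = record
  { V        = V G
  ; _~_      = λ x y → x ≢ y × ¬ (x ~ y)
  ; ~-irrefl = λ x≡y (x≢y , _) → x≢y x≡y
  ; ~-sym    = λ (x≢y , x≁y) → ≢-sym x≢y , λ y~x → x≁y (~-sym y~x)
  }
  where open Graph G

-- Membership in C is proof-irrelevant in the vertex type, so that a vertex
-- lying in C in several ways still counts once.
_[_] : (G : Graph v e) → Pred (V G) p → Graph (v ⊔ p) e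
G [ C ] = record
  { V        = Refinement (V G) C
  ; _~_      = λ x y → value x ~ value y
  ; ~-irrefl = λ { refl → ~-irrefl refl }
  ; ~-sym    = ~-sym
  }
  where open Graph G

infix 4 _≅_ _≤ᵢ_

_≅_ : Graph v e → Graph v′ e′ → Set (v ⊔ e ⊔ v′ ⊔ e′)
G ≅ H = Σ[ f ∈ V G ↔ V H ]
          (∀ x y → x G.~ y ⇔ Inverse.to f x H.~ Inverse.to f y)
  where
  module G = Graph G
  module H = Graph H

-- G is isomorphic to an induced subgraph of H.  The vertex subset ranges over
-- a universe large enough to contain the image of any map V G → V H.
_≤ᵢ_ : Graph v e → Graph v′ e′ → Set (suc (v ⊔ v′) ⊔ e ⊔ e′)
_≤ᵢ_ {v = v} {v′ = v′} G H = Σ[ C ∈ Pred (V H) (v ⊔ v′) ] G ≅ H [ C ]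

Forb : Pred (Graph v e) ℓ → Pred (Graph v′ e′) (suc (v ⊔ v′ ⊔ e) ⊔ e′ ⊔ ℓ)
Forb 𝓕 G = ∀ F → F ∈ 𝓕 → ¬ (F ≤ᵢ G)

-- The simple graph whose edges are the pairs {x , y} with x ≢ y and R x y.
simple : {A : Set v} → Rel A r → Graph v (v ⊔ r)
simple {A = A} R = record
  { V        = A
  ; _~_      = λ x y → x ≢ y × SymClosure R x y
  ; ~-irrefl = λ x≡y (x≢y , _) → x≢y x≡y
  ; ~-sym    = λ (x≢y , xRy) → ≢-sym x≢y , symmetric R xRy
  }

data ClawVertex : Set where
  centre : ClawVertex
  leaf   : Fin 3 → ClawVertex

data ClawEdge : Rel ClawVertex 0ℓ where
  spoke : ∀ i → ClawEdge centre (leaf i)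

K₁,₃ : Graph 0ℓ 0ℓ
K₁,₃ = simple ClawEdge

data A₆Vertex : Set where
  a b c a′ b′ c′ : A₆Vertex

data A₆Edge : Rel A₆Vertex 0ℓ where
  ab  : A₆Edge a b
  bc  : A₆Edge b c
  ca  : A₆Edge c a
  a′b : A₆Edge a′ b
  a′c : A₆Edge a′ c
  b′a : A₆Edge b′ a
  b′c : A₆Edge b′ c
  c′a : A₆Edge c′ a
  c′b : A₆Edge c′ b

A₆ : Graph 0ℓ 0ℓ
A₆ = simple A₆Edge

P₉ : Graph 0ℓ 0ℓ
P₉ = record
  { V        = Fin 3 × Fin 3
  ; _~_      = λ (i , j) (k , l) → (i ≡ k × j ≢ l) ⊎ (i ≢ k × j ≡ l)
  ; ~-irrefl = λ { refl (inj₁ (_ , j≢j)) → j≢j refl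
                 ; refl (inj₂ (i≢i , _)) → i≢i refl }
  ; ~-sym    = λ { (inj₁ (i≡k , j≢l)) → inj₁ (sym i≡k , ≢-sym j≢l)
                 ; (inj₂ (i≢k , j≡l)) → inj₂ (≢-sym i≢k , sym j≡l) }
  }

singleVertex : Graph 0ℓ 0ℓ
singleVertex = simple {A = Fin 1} (λ _ _ → ⊥)

-- For n ≥ 3 this is the cycle of length n; smaller n are not meaningful.
cycle : ℕ → Graph 0ℓ 0ℓ
cycle n = simple {A = Fin n} λ i j →
  (toℕ j ≡ ℕ.suc (toℕ i)) ⊎ (ℕ.suc (toℕ i) ≡ n × toℕ j ≡ 0)

finitePath : ℕ → Graph 0ℓ 0ℓ
finitePath n = simple {A = Fin n} λ i j → toℕ j ≡ ℕ.suc (toℕ i)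

oneWayInfinitePath : Graph 0ℓ 0ℓ
oneWayInfinitePath = simple {A = ℕ} λ i j → j ≡ ℕ.suc i

twoWayInfinitePath : Graph 0ℓ 0ℓ
twoWayInfinitePath = simple {A = ℤ.ℤ} λ i j → j ≡ ℤ.suc i

IsLongCycle : Pred (Graph v e) (v ⊔ e)
IsLongCycle H = ∃[ n ] 4 ≤ n × H ≅ cycle n

IsPath : Pred (Graph v e) (v ⊔ e)
IsPath H = (∃[ n ] H ≅ finitePath n)
         ⊎ H ≅ oneWayInfinitePath
         ⊎ H ≅ twoWayInfinitePath

IsIsolatedVertex : Pred (Graph v e) (v ⊔ e)
IsIsolatedVertex H = H ≅ singleVertex

component : (G : Graph v e) → V G → Graph (v ⊔ e) e
component G x = G [ Star _~_ x ]
  where open Graph G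

CyclesAndPaths : Pred (Graph v e) (v ⊔ e)
CyclesAndPaths G = ∀ x → let H = component G x in
  IsLongCycle H ⊎ IsPath H ⊎ IsIsolatedVertex H

Listed : Pred (Graph v e) (suc v ⊔ e)
Listed G = G ≅ A₆ ⊎ G ≤ᵢ P₉ ⊎ CyclesAndPaths G

module Submission where

-- If G has no triangle, claw-freeness bounds the degrees by two.  Follow a walk that never
-- turns back unless it must: started at an end of a path it sweeps out a finite or one-way
-- infinite path; if the component has no end, it either closes up into a cycle, of length
-- at least 4, or forms a two-way infinite path with the walk in the opposite direction.
-- If the complement has no triangle, the same applies to it.
--
-- Otherwise a triangle and an independent triple exist, and one of each can be chosen to
-- meet in a vertex; their union is then a bull.  The bull embeds in P₉, and a further
-- vertex is attached to it in one of only six ways: as one of the four remaining vertices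
-- of P₉, or completing A₆ (the sun) or its complement (the net).  A sun or a net cannot be
-- extended further, so then G or its complement is A₆.  If neither occurs, every vertex
-- has a position in P₉, and the relation between two vertices is forced by their positions.

open import Defs
open import Level using (Level; _⊔_; 0ℓ; Lift; lift; lower)
open import Axiom.ExcludedMiddle using (ExcludedMiddle)
open import Data.Empty using (⊥)
open import Data.Fin.Base using (Fin; zero; suc; toℕ; fromℕ; fromℕ<; inject₁; combine; remQuot)
open import Data.Fin.Patterns using (0F; 1F; 2F; 3F; 4F; 5F; 8F)
open import Data.Fin.Properties
  using (_≟_; any?; all?; toℕ<n; toℕ-injective; toℕ-fromℕ; toℕ-fromℕ<; toℕ-inject₁; remQuot-combine)
open import Data.Integer.Base as ℤ using (ℤ; +_; -[1+_])
import Data.Integer.Properties as ℤ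
open import Data.Irrelevant using () renaming ([_] to irr)
open import Data.Nat.Base using (ℕ; zero; suc; _+_; _≤_; _<_; z<s; s<s; z≤n; s≤s; s<s⁻¹)
open import Data.Nat.Properties as ℕ using (<-cmp)
open import Data.Product.Base using (Σ-syntax; ∃; ∃-syntax; _×_; _,_; proj₁; proj₂)
open import Data.Refinement.Base using (Refinement; value; _,_)
open import Data.Sum.Base as Sum using (_⊎_; inj₁; inj₂; [_,_]′)
open import Data.Vec.Base using (Vec; []; _∷_; map; lookup)
open import Data.Vec.Properties using (≡-dec)
open import Data.Vec.Relation.Binary.Pointwise.Inductive as Pointwise using (Pointwise; []; _∷_)
open import Data.Vec.Relation.Unary.Any as Any using (Any)
open import Function.Base using (_∘_; id)
open import Function.Bundles using (_⇔_; mk⇔; mk↔ₛ′; Inverse; Injection; Equivalence)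
open import Function.Properties.Inverse using (↔⇒↣)
open import Relation.Binary.Core using (Rel)
open import Relation.Binary.Construct.Closure.ReflexiveTransitive
  using (Star; ε; _◅_; _◅◅_; reverse)
open import Relation.Binary.Construct.Closure.Symmetric using (SymClosure; fwd; bwd)
open import Relation.Binary.Definitions using (tri<; tri≈; tri>)
open import Relation.Binary.PropositionalEquality
  using (_≡_; _≢_; refl; sym; trans; cong; subst; ≢-sym)
open import Relation.Nullary.Decidable
  using (Dec; yes; no; from-yes; map′; recompute; _×-dec_; _⊎-dec_; ¬?)
open import Relation.Nullary.Negation using (¬_; contradiction)
open import Relation.Unary using (Decidable; _∈_; _∪_; ｛_｝)

open Graph

private
  variable
    v e v′ e′ : Level
    n : ℕ

lower-em : ∀ ℓ {m} → ExcludedMiddle (ℓ ⊔ m) → ExcludedMiddle ℓ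
lower-em ℓ {m} em {P} = map′ lower lift (em {Lift m P})

-- Relations between two vertices and their codes

data Kind : Set where
  eq adj non : Kind

_≟ᵏ_ : (s t : Kind) → Dec (s ≡ t)
eq  ≟ᵏ eq  = yes refl
eq  ≟ᵏ adj = no λ ()
eq  ≟ᵏ non = no λ ()
adj ≟ᵏ eq  = no λ ()
adj ≟ᵏ adj = yes refl
adj ≟ᵏ non = no λ ()
non ≟ᵏ eq  = no λ ()
non ≟ᵏ adj = no λ ()
non ≟ᵏ non = yes refl

dual : Kind → Kind
dual eq  = eq
dual adj = non
dual non = adj

dual-involutive : ∀ k → dual (dual k) ≡ k
dual-involutive eq  = refl
dual-involutive adj = refl
dual-involutive non = refl

-- The index is a decidable code for the relation between x and y, so that questions about finitely
-- many vertices become computations with codes.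
data Related (G : Graph v e) (x y : V G) : Kind → Set (v ⊔ e) where
  same : x ≡ y → Related G x y eq
  edge : _~_ G x y → Related G x y adj
  gap  : x ≢ y → ¬ _~_ G x y → Related G x y non

module _ {G : Graph v e} where

  related-sym : ∀ {x y k} → Related G x y k → Related G y x k
  related-sym (same x≡y)     = same (sym x≡y)
  related-sym (edge x~y)     = edge (~-sym G x~y)
  related-sym (gap x≢y x≁y)  = gap (≢-sym x≢y) (x≁y ∘ ~-sym G)

  related-unique : ∀ {x y s t} → Related G x y s → Related G x y t → s ≡ t
  related-unique (same _)      (same _)      = refl
  related-unique (same x≡y)    (edge x~y)    = contradiction x~y (~-irrefl G x≡y)
  related-unique (same x≡y)    (gap x≢y _)   = contradiction x≡y x≢y
  related-unique (edge x~y)    (same x≡y)    = contradiction x~y (~-irrefl G x≡y)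
  related-unique (edge _)      (edge _)      = refl
  related-unique (edge x~y)    (gap _ x≁y)   = contradiction x~y x≁y
  related-unique (gap x≢y _)   (same x≡y)    = contradiction x≡y x≢y
  related-unique (gap _ x≁y)   (edge x~y)    = contradiction x~y x≁y
  related-unique (gap _ _)     (gap _ _)     = refl

  related-complement : ∀ {x y k} → Related G x y k → Related (complement G) x y (dual k)
  related-complement (same x≡y)    = same x≡y
  related-complement (edge x~y)    =
    gap (λ x≡y → ~-irrefl G x≡y x~y) (λ (_ , x≁y) → x≁y x~y)
  related-complement (gap x≢y x≁y) = edge (x≢y , x≁y)

Trichotomous : Graph v e → Set (v ⊔ e)
Trichotomous G = ∀ x y → ∃ (Related G x y)

module _ {G : Graph v e} (tri : Trichotomous G) where

  complement-trichotomous : Trichotomous (complement G)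
  complement-trichotomous x y = let _ , r = tri x y in _ , related-complement r

  -- Unfolding a nonedge of the complement yields only a doubly negated edge of `G`; the kind in `G`
  -- is therefore taken from `tri` and identified by uniqueness.
  complement-related : ∀ {x y} k → Related (complement G) x y k → Related G x y (dual k)
  complement-related {x} {y} k r with j , s ← tri x y
    rewrite related-unique {G = complement G} r (related-complement s) =
      subst (Related G x y) (sym (dual-involutive j)) s

em⇒trichotomous : ExcludedMiddle (v ⊔ e) → (G : Graph v e) → Trichotomous G
em⇒trichotomous {v} {e} em G x y with lower-em v {e} em {x ≡ y}
... | yes x≡y = eq , same x≡y
... | no x≢y with lower-em e {v} em {_~_ G x y}
...   | yes x~y = adj , edge x~y
...   | no x≁y  = non , gap x≢y x≁y

-- Induced embeddings and isomorphisms

infix 4 _↪_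

-- All three kinds are preserved, not just edges; with `Trichotomous F` this gives injectivity and
-- reflection of adjacency, hence an induced embedding.
_↪_ : Graph v e → Graph v′ e′ → Set (v ⊔ e ⊔ v′ ⊔ e′)
F ↪ G = Σ[ f ∈ (V F → V G) ] ∀ {x y k} → Related F x y k → Related G (f x) (f y) k

module _ {F : Graph v e} {G : Graph v′ e′} (tri : Trichotomous F) where

  -- The kind that `tri` assigns to x and y is carried over to their images, where uniqueness
  -- equates it with k.
  reflects : ((f , _) : F ↪ G) → ∀ {x y} k → Related G (f x) (f y) k → Related F x y k
  reflects (f , pres) {x} {y} k r with j , s ← tri x y
    rewrite related-unique {G = G} r (pres s) = s

  ↪-injective : ((f , _) : F ↪ G) → ∀ {x y} → f x ≡ f y → x ≡ y
  ↪-injective f↪ fx≡fy with reflects f↪ eq (same fx≡fy)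
  ... | same x≡y = x≡y

  ↪-adjacent : ((f , _) : F ↪ G) → ∀ x y → _~_ F x y ⇔ _~_ G (f x) (f y)
  ↪-adjacent f↪@(f , pres) x y = mk⇔ to from
    where
    to : _~_ F x y → _~_ G (f x) (f y)
    to x~y with pres (edge x~y)
    ... | edge fx~fy = fx~fy

    from : _~_ G (f x) (f y) → _~_ F x y
    from fx~fy with reflects f↪ adj (edge fx~fy)
    ... | edge x~y = x~y

≅-sym : {F : Graph v e} {G : Graph v′ e′} → F ≅ G → G ≅ F
≅-sym {F = F} {G = G} (i , pres) =
  mk↔ₛ′ from to strictlyInverseʳ strictlyInverseˡ , λ x y → mk⇔
    (λ x~y → Equivalence.from (pres (from x) (from y))
       (subst (λ p → _~_ G p (to (from y))) (sym (strictlyInverseˡ x))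
         (subst (_~_ G x) (sym (strictlyInverseˡ y)) x~y)))
    (λ x~y → subst (λ p → _~_ G p y) (strictlyInverseˡ x)
       (subst (_~_ G (to (from x))) (strictlyInverseˡ y)
         (Equivalence.to (pres (from x) (from y)) x~y)))
  where open Inverse i

surjective-embedding⇒≅ : {F : Graph v e} {G : Graph v′ e′} (f : V F → V G) (g : V G → V F) →
  (∀ w → f (g w) ≡ w) → (∀ {x y} → f x ≡ f y → x ≡ y) →
  (∀ x y → _~_ F x y ⇔ _~_ G (f x) (f y)) → F ≅ G
surjective-embedding⇒≅ f g fg≡ injective adjacent =
  mk↔ₛ′ f g fg≡ (λ x → injective (fg≡ (f x))) , adjacent

≅⇒↪ : {F : Graph v e} {G : Graph v′ e′} → F ≅ G → F ↪ G
≅⇒↪ {F = F} {G = G} (i , adjacent) = Inverse.to i , pres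
  where
  pres : ∀ {x y k} → Related F x y k → Related G (Inverse.to i x) (Inverse.to i y) k
  pres (same x≡y)    = same (cong (Inverse.to i) x≡y)
  pres (edge x~y)    = edge (Equivalence.to (adjacent _ _) x~y)
  pres (gap x≢y x≁y) =
    gap (x≢y ∘ Injection.injective (↔⇒↣ i)) (x≁y ∘ Equivalence.from (adjacent _ _))

≤ᵢ⇒↪ : {F : Graph v e} {G : Graph v′ e′} → F ≤ᵢ G → F ↪ G
≤ᵢ⇒↪ {G = G} (C , F≅G[C]) with f , pres ← ≅⇒↪ {G = G [ C ]} F≅G[C] = value ∘ f , forget ∘ pres
  where
  forget : ∀ {x y k} → Related (G [ C ]) x y k → Related G (value x) (value y) k
  forget (same x≡y)    = same (cong value x≡y)
  forget (edge x~y)    = edge x~y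
  forget (gap x≢y x≁y) = gap (λ { refl → x≢y refl }) x≁y

↪⇒≤ᵢ : {F : Graph v e} {G : Graph v′ e′} → ExcludedMiddle (v ⊔ v′) →
  Trichotomous F → F ↪ G → F ≤ᵢ G
↪⇒≤ᵢ {v = v} {v′ = v′} {F = F} {G = G} em tri f↪@(f , _) =
  Image , surjective-embedding⇒≅ {F = F} {G = G [ Image ]}
    (λ x → f x , irr (x , refl))
    (λ w → proj₁ (preimage w))
    (λ w → value-injective (proj₂ (preimage w)))
    (λ fx≡fy → ↪-injective {F = F} {G = G} tri f↪ (cong value fx≡fy))
    (↪-adjacent tri f↪)
  where
  Image : V G → Set (v ⊔ v′)
  Image y = ∃[ x ] f x ≡ y

  -- Membership in a refinement is irrelevant; excluded middle decides `Image`, so that a preimage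
  -- can be recomputed.
  preimage : (w : Refinement (V G) Image) → Image (value w)
  preimage (w , irr p) = recompute em p

  value-injective : {x y : Refinement (V G) Image} → value x ≡ value y → x ≡ y
  value-injective refl = refl

-- Claws and their complements

record Tripod {ℓ m} {A : Set ℓ} (S : A → A → Kind → Set m) (s t : Kind) : Set (ℓ ⊔ m) where
  constructor tripod
  field
    -- Kinds `adj`, `non` give a claw, kinds `non`, `adj` its complement. `S` is abstract so that
    -- vertices of a graph and indices of a finite table are treated alike. Each condition follows
    -- the last vertex it mentions, which lets the search in `tripod?` stop early.
    foot-and-ends :
      ∃[ p ] ∃[ x ] S p x s × ∃[ y ] S p y s × S x y t × ∃[ z ] S p z s × S x z t × S y z t

map-tripod : ∀ {ℓ m ℓ′ m′} {A : Set ℓ} {B : Set ℓ′} {S : A → A → Kind → Set m}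
  {T : B → B → Kind → Set m′} {s t s′ t′} (f : A → B) →
  (∀ {x y} → S x y s → T (f x) (f y) s′) → (∀ {x y} → S x y t → T (f x) (f y) t′) →
  Tripod S s t → Tripod T s′ t′
map-tripod f g h (tripod (p , x , px , y , py , xy , z , pz , xz , yz)) =
  tripod (f p , f x , g px , f y , g py , h xy , f z , g pz , h xz , h yz)

tripod-complement : {G : Graph v e} {s t : Kind} →
  Tripod (Related G) s t → Tripod (Related (complement G)) (dual s) (dual t)
tripod-complement = map-tripod id related-complement related-complement

Clean : Graph v e → Set (v ⊔ e)
Clean G = ¬ Tripod (Related G) adj non × ¬ Tripod (Related G) non adj

clean-complement : {G : Graph v e} → Trichotomous G → Clean G → Clean (complement G)
clean-complement {G = G} tri (noClaw , noCoclaw) = noCoclaw ∘ back , noClaw ∘ back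
  where
  back : ∀ {s t} → Tripod (Related (complement G)) s t → Tripod (Related G) (dual s) (dual t)
  back = map-tripod id (complement-related {G = G} tri _) (complement-related {G = G} tri _)

clean-complement⁻¹ : {G : Graph v e} → Clean (complement G) → Clean G
clean-complement⁻¹ {G = G} (noClaw , noCoclaw) =
  noCoclaw ∘ tripod-complement {G = G} , noClaw ∘ tripod-complement {G = G}

clean-↪ : {F : Graph v e} {G : Graph v′ e′} → F ↪ G → Clean G → Clean F
clean-↪ (f , pres) (noClaw , noCoclaw) =
  noClaw ∘ map-tripod f pres pres , noCoclaw ∘ map-tripod f pres pres

K₁,₃-tripod : Tripod (Related K₁,₃) adj non
K₁,₃-tripod =
  tripod (centre , leaf zero , spokes , leaf (suc zero) , spokes , leaves (λ ()) ,
    leaf (suc (suc zero)) , spokes , leaves (λ ()) , leaves (λ ()))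
  where
  spokes : ∀ {i} → Related K₁,₃ centre (leaf i) adj
  spokes = edge ((λ ()) , fwd (spoke _))

  leaves : ∀ {i j} → leaf i ≢ leaf j → Related K₁,₃ (leaf i) (leaf j) non
  leaves i≢j = gap i≢j λ { (_ , fwd ()) ; (_ , bwd ()) }

K₁,₃-trichotomous : Trichotomous K₁,₃
K₁,₃-trichotomous centre   centre   = eq , same refl
K₁,₃-trichotomous centre   (leaf i) = adj , edge ((λ ()) , fwd (spoke i))
K₁,₃-trichotomous (leaf i) centre   = adj , edge ((λ ()) , bwd (spoke i))
K₁,₃-trichotomous (leaf i) (leaf j) with i ≟ j
... | yes i≡j = eq , same (cong leaf i≡j)
... | no i≢j  = non , gap (λ { refl → i≢j refl }) λ { (_ , fwd ()) ; (_ , bwd ()) }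

tripod⇒K₁,₃↪ : {G : Graph v e} → Tripod (Related G) adj non → K₁,₃ ↪ G
tripod⇒K₁,₃↪ {G = G} (tripod (p , x , px , y , py , xy , z , pz , xz , yz)) = f , pres
  where
  f : ClawVertex → V G
  f centre                 = p
  f (leaf zero)            = x
  f (leaf (suc zero))      = y
  f (leaf (suc (suc zero))) = z

  spokes : ∀ i → Related G p (f (leaf i)) adj
  spokes zero             = px
  spokes (suc zero)       = py
  spokes (suc (suc zero)) = pz

  leaves : ∀ i j → i ≢ j → Related G (f (leaf i)) (f (leaf j)) non
  leaves zero             zero             i≢j = contradiction refl i≢j
  leaves zero             (suc zero)       _   = xy
  leaves zero             (suc (suc zero)) _   = xz
  leaves (suc zero)       zero             _   = related-sym xy
  leaves (suc zero)       (suc zero)       i≢j = contradiction refl i≢j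
  leaves (suc zero)       (suc (suc zero)) _   = yz
  leaves (suc (suc zero)) zero             _   = related-sym xz
  leaves (suc (suc zero)) (suc zero)       _   = related-sym yz
  leaves (suc (suc zero)) (suc (suc zero)) i≢j = contradiction refl i≢j

  pres : ∀ {q r k} → Related K₁,₃ q r k → Related G (f q) (f r) k
  pres (same refl)                         = same refl
  pres (edge (_ , fwd (spoke i)))          = spokes i
  pres (edge (_ , bwd (spoke i)))          = related-sym (spokes i)
  pres {centre} {centre} (gap q≢r _)       = contradiction refl q≢r
  pres {centre} {leaf i} (gap q≢r q≁r)     = contradiction (q≢r , fwd (spoke i)) q≁r
  pres {leaf i} {centre} (gap q≢r q≁r)     = contradiction (q≢r , bwd (spoke i)) q≁r
  pres {leaf i} {leaf j} (gap q≢r _)       = leaves i j (q≢r ∘ cong leaf)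

Forbidden : Graph v e → Set (Level.suc v ⊔ e)
Forbidden G = G ∈ Forb (｛ K₁,₃ ｝ ∪ ｛ complement K₁,₃ ｝)

forbidden⇔clean : ExcludedMiddle (v ⊔ e) → (G : Graph v e) → Forbidden G ⇔ Clean G
forbidden⇔clean {v} {e} em G = mk⇔ to from
  where
  tri : Trichotomous G
  tri = em⇒trichotomous em G

  em-v : ExcludedMiddle v
  em-v = lower-em v {e} em

  to : Forbidden G → Clean G
  to forb =
    (λ claw → forb K₁,₃ (inj₁ refl) (↪⇒≤ᵢ em-v K₁,₃-trichotomous (tripod⇒K₁,₃↪ claw))) ,
    λ coclaw → forb (complement K₁,₃) (inj₂ refl)
      (↪⇒≤ᵢ em-v (complement-trichotomous K₁,₃-trichotomous)
        (co-↪ (tripod⇒K₁,₃↪ (tripod-complement {G = G} coclaw))))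
    where
    -- The same map serves: a kind in `complement K₁,₃` is dualised to `K₁,₃`, carried to
    -- `complement G`, and dualised back.
    co-↪ : K₁,₃ ↪ complement G → complement K₁,₃ ↪ G
    co-↪ (f , pres) = f , λ {x} {y} {k} r →
      subst (Related G (f x) (f y)) (dual-involutive k)
        (complement-related {G = G} tri (dual k)
          (pres (complement-related {G = K₁,₃} K₁,₃-trichotomous k r)))

  from : Clean G → Forbidden G
  from (noClaw , _) F (inj₁ refl) F≤G =
    let _ , pres = ≤ᵢ⇒↪ {F = F} {G = G} F≤G in noClaw (map-tripod _ pres pres K₁,₃-tripod)
  from (_ , noCoclaw) F (inj₂ refl) F≤G =
    let _ , pres = ≤ᵢ⇒↪ {F = F} {G = G} F≤G in
    noCoclaw (map-tripod _ pres pres (tripod-complement {G = K₁,₃} K₁,₃-tripod))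

-- Walks in graphs of maximum degree two

least : ∀ {ℓ} → ExcludedMiddle ℓ → (P : ℕ → Set ℓ) → ∀ n → P n →
  ∃[ m ] P m × (∀ k → k < m → ¬ P k)
least em P n pn with em {P 0}
... | yes p0 = 0 , p0 , λ _ ()
least em P zero    pn | no ¬p0 = contradiction pn ¬p0
least em P (suc n) pn | no ¬p0 with least em (P ∘ suc) n pn
... | m , pm , below = suc m , pm , λ { zero _ → ¬p0 ; (suc k) k<m → below k (s<s⁻¹ k<m) }

Triangle : Graph v e → Set (v ⊔ e)
Triangle G = ∃[ x ] ∃[ y ] ∃[ z ] x ~ᴳ y × y ~ᴳ z × x ~ᴳ z
  where _~ᴳ_ = _~_ G

MaxDegree≤2 : Graph v e → Set (v ⊔ e)
MaxDegree≤2 G = ∀ {x p q r} → x ~ᴳ p → x ~ᴳ q → x ~ᴳ r → p ≡ q ⊎ p ≡ r ⊎ q ≡ r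
  where _~ᴳ_ = _~_ G

-- Among three distinct neighbours an adjacent pair closes a triangle; without such a pair there is
-- a claw.
clean⇒degree≤2 : ExcludedMiddle (v ⊔ e) → (G : Graph v e) → ¬ Triangle G → Clean G → MaxDegree≤2 G
clean⇒degree≤2 em G noTriangle (noClaw , _) {x} {p} {q} {r} x~p x~q x~r
  with em⇒trichotomous em G p q | em⇒trichotomous em G p r | em⇒trichotomous em G q r
... | _ , same p≡q | _              | _            = inj₁ p≡q
... | _ , edge p~q | _              | _            =
  contradiction (x , p , q , x~p , p~q , x~q) noTriangle
... | _            | _ , same p≡r   | _            = inj₂ (inj₁ p≡r)
... | _            | _ , edge p~r   | _            =
  contradiction (x , p , r , x~p , p~r , x~r) noTriangle
... | _            | _              | _ , same q≡r = inj₂ (inj₂ q≡r)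
... | _            | _              | _ , edge q~r =
  contradiction (x , q , r , x~q , q~r , x~r) noTriangle
... | _ , pq@(gap _ _) | _ , pr@(gap _ _) | _ , qr@(gap _ _) =
  contradiction (tripod (x , p , edge x~p , q , edge x~q , pq , r , edge x~r , pr , qr)) noClaw

module _ (em : ExcludedMiddle (v ⊔ e)) (G : Graph v e) where

  private
    _~ᴳ_ : Rel (V G) e
    _~ᴳ_ = _~_ G

  -- By `closed`, a walk starting at a listed vertex stays on the list, and `reach` keeps the list
  -- inside the component; `i₀` provides a listed vertex to start from.
  component-≅ : {I : Set} {R : Rel I 0ℓ} (f : I → V G) →
    (∀ {i j} → f i ≡ f j → i ≡ j) → (∀ {i j} → R i j → f i ~ᴳ f j) →
    (∀ i {w} → f i ~ᴳ w → ∃[ j ] SymClosure R i j × w ≡ f j) →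
    ∀ {x} → (∀ i → Star _~ᴳ_ x (f i)) → I → component G x ≅ simple R
  component-≅ {I} {R} f injective adjacent closed {x} reach i₀ =
    ≅-sym {F = simple R} {G = component G x}
      (surjective-embedding⇒≅ {F = simple R} {G = component G x}
        (λ i → f i , irr (reach i)) (proj₁ ∘ index) (value-injective ∘ sym ∘ proj₂ ∘ index)
        (injective ∘ cong value) λ i j → mk⇔ (to i j) (from i j))
    where
    value-injective : {p q : V (component G x)} → value p ≡ value q → p ≡ q
    value-injective refl = refl

    along : ∀ {p w} → Star _~ᴳ_ p w → ∀ i → p ≡ f i → ∃[ j ] w ≡ f j
    along ε            i refl = i , refl
    along (p~q ◅ q⇝w) i refl = let j , _ , q≡fj = closed i p~q in along q⇝w j q≡fj

    index : (w : V (component G x)) → ∃[ j ] value w ≡ f j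
    -- The walk starts at `f i₀`, runs backwards to x and then follows the irrelevant witness `x⇝w`,
    -- recovered by excluded middle.
    index (w , irr x⇝w) =
      along (reverse (~-sym G) (reach i₀) ◅◅ recompute em x⇝w) i₀ refl

    to : ∀ i j → i ≢ j × SymClosure R i j → f i ~ᴳ f j
    to i j (_ , fwd r) = adjacent r
    to i j (_ , bwd r) = ~-sym G (adjacent r)

    from : ∀ i j → f i ~ᴳ f j → i ≢ j × SymClosure R i j
    from i j fi~fj with k , r , fj≡fk ← closed i fi~fj with refl ← injective fj≡fk =
      (λ i≡j → ~-irrefl G (cong f i≡j) fi~fj) , r

  -- Turning back, `f i ≡ f (2 + i)`, is permitted; `closed` then says that `f (suc i)` has a single
  -- neighbour. The neighbours of `f 0` are handled separately, by an end condition or by the degree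
  -- bound.
  record IsWalk (f : ℕ → V G) : Set (v ⊔ e) where
    field
      adjacent : ∀ i → f i ~ᴳ f (suc i)
      closed   : ∀ i {w} → f (suc i) ~ᴳ w → w ≡ f i ⊎ w ≡ f (2 + i)

    Distinct : ℕ → Set v
    Distinct n = ∀ {i j} → i < j → j < n → f i ≢ f j

    reach : ∀ i → Star _~ᴳ_ (f 0) (f i)
    reach zero    = ε
    reach (suc i) = reach i ◅◅ (adjacent i ◅ ε)

    distinct⇒injective : (∀ n → Distinct n) → ∀ {i j} → f i ≡ f j → i ≡ j
    distinct⇒injective distinct {i} {j} fi≡fj with <-cmp i j
    ... | tri< i<j _ _ = contradiction fi≡fj (distinct (suc j) i<j ℕ.≤-refl)
    ... | tri≈ _ i≡j _ = i≡j
    ... | tri> _ _ j<i = contradiction (sym fi≡fj) (distinct (suc i) j<i ℕ.≤-refl)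

    distinct⇒injective-Fin : ∀ {n} → Distinct n → {i j : Fin n} → f (toℕ i) ≡ f (toℕ j) → i ≡ j
    distinct⇒injective-Fin distinct {i} {j} fi≡fj with <-cmp (toℕ i) (toℕ j)
    ... | tri< i<j _ _ = contradiction fi≡fj (distinct i<j (toℕ<n j))
    ... | tri≈ _ i≡j _ = toℕ-injective i≡j
    ... | tri> _ _ j<i = contradiction (sym fi≡fj) (distinct j<i (toℕ<n i))

    -- A walk that has not turned back can only come back to its first vertex,
    -- since the two neighbours of any later vertex are already on the walk.
    return-to-start : ∀ {n} → Distinct n → (∀ i → 1 + i < n → f i ≢ f (2 + i)) →
      ∀ i → i < n → f i ≡ f n → i ≡ 0
    return-to-start _ _ zero _ _ = refl
    return-to-start {suc m} distinct straight (suc k) (s≤s k<m) fi≡fn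
      with closed k (subst (_~ᴳ f m) (sym fi≡fn) (~-sym G (adjacent m)))
    ... | inj₁ fm≡fk = contradiction (sym fm≡fk) (distinct k<m ℕ.≤-refl)
    ... | inj₂ fm≡f2+k with <-cmp (suc k) m
    ...   | tri> _ _ m<1+k = contradiction k<m (ℕ.<⇒≱ m<1+k)
    ...   | tri≈ _ refl _  = contradiction (adjacent m) (~-irrefl G fi≡fn)
    ...   | tri< 1+k<m _ _ with <-cmp (2 + k) m
    ...     | tri> _ _ m<2+k = contradiction 1+k<m (ℕ.<⇒≱ m<2+k)
    ...     | tri≈ _ refl _  = contradiction fi≡fn (straight (suc k) ℕ.≤-refl)
    ...     | tri< 2+k<m _ _ = contradiction (sym fm≡f2+k) (distinct 2+k<m ℕ.≤-refl)

    -- Induction on the length: the newest vertex can only repeat `f 0`, by `return-to-start`. Its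
    -- predecessor is then a neighbour of the end `f 0`, hence equal to `f 1`, and the shorter walk
    -- already has a repetition. The lengths up to 3 are too short for this and are treated
    -- directly.
    distinct-from-end : (∀ {w} → f 0 ~ᴳ w → w ≡ f 1) →
      ∀ n → (∀ i → 2 + i < n → f i ≢ f (2 + i)) → Distinct n
    distinct-from-end end (suc n) straight {i} {j} i<j j<1+n fi≡fj
      with ℕ.m<1+n⇒m<n∨m≡n j<1+n
    ... | inj₁ j<n = distinct-from-end end n (λ i → straight i ∘ ℕ.m<n⇒m<1+n) i<j j<n fi≡fj
    ... | inj₂ refl
      with return-to-start {n} (distinct-from-end end n λ i → straight i ∘ ℕ.m<n⇒m<1+n)
             (λ i → straight i ∘ s<s) i i<j fi≡fj
    distinct-from-end end 1 _ () _ _ | inj₂ refl | refl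
    distinct-from-end end 2 _ _ _ f0≡f1 | inj₂ refl | refl = ~-irrefl G f0≡f1 (adjacent 0)
    distinct-from-end end 3 straight _ _ f0≡f2 | inj₂ refl | refl = straight 0 ℕ.≤-refl f0≡f2
    distinct-from-end end (suc n@(suc (suc (suc m)))) straight _ _ f0≡fn | inj₂ refl | refl =
      distinct-from-end end n (λ i → straight i ∘ ℕ.m<n⇒m<1+n) (s<s z<s) ℕ.≤-refl
        (sym (end (subst (_~ᴳ f (2 + m)) (sym f0≡fn) (~-sym G (adjacent (2 + m))))))

    -- Here n is the first index at which the walk turns back, so `f (suc n)` is the other end and
    -- the path has the `2 + n` vertices from `f 0` to `f (suc n)`.
    finite-path : (∀ {w} → f 0 ~ᴳ w → w ≡ f 1) → ∀ n →
      (∀ i → i < n → f i ≢ f (2 + i)) → f n ≡ f (2 + n) →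
      ∀ {x} → Star _~ᴳ_ x (f 0) → component G x ≅ finitePath (2 + n)
    finite-path end n straight turn x⇝f0 =
      component-≅ (f ∘ toℕ)
        (distinct⇒injective-Fin (distinct-from-end end (2 + n) λ i → straight i ∘ s<s⁻¹ ∘ s<s⁻¹))
        (λ {i} j≡1+i → subst (λ k → f (toℕ i) ~ᴳ f k) (sym j≡1+i) (adjacent (toℕ i)))
        neighbours (λ i → x⇝f0 ◅◅ reach (toℕ i)) zero
      where
      neighbours : (i : Fin (2 + n)) → ∀ {w} → f (toℕ i) ~ᴳ w →
        ∃[ j ] SymClosure (λ i j → toℕ j ≡ suc (toℕ i)) i j × w ≡ f (toℕ j)
      neighbours zero f0~w = suc zero , fwd refl , end f0~w
      neighbours (suc i) fi~w with closed (toℕ i) fi~w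
      ... | inj₁ w≡fi =
        inject₁ i , bwd (cong suc (sym (toℕ-inject₁ i))) ,
        trans w≡fi (cong f (sym (toℕ-inject₁ i)))
      ... | inj₂ w≡f2+i with ℕ.m<1+n⇒m<n∨m≡n (toℕ<n i)
      ...   | inj₁ i<n = fromℕ< (s<s (s<s i<n)) , fwd (toℕ-fromℕ< (s<s (s<s i<n))) ,
                         trans w≡f2+i (cong f (sym (toℕ-fromℕ< (s<s (s<s i<n)))))
      -- At the last vertex the walk turns back, so the neighbour ahead is again the one behind.
      ...   | inj₂ i≡n =
        inject₁ i , bwd (cong suc (sym (toℕ-inject₁ i))) ,
        trans w≡f2+i (trans (cong (λ k → f (2 + k)) i≡n)
          (trans (sym turn) (cong f (trans (sym i≡n) (sym (toℕ-inject₁ i))))))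

    one-way-path : (∀ {w} → f 0 ~ᴳ w → w ≡ f 1) → (∀ i → f i ≢ f (2 + i)) →
      ∀ {x} → Star _~ᴳ_ x (f 0) → component G x ≅ oneWayInfinitePath
    one-way-path end straight x⇝f0 =
      component-≅ f (distinct⇒injective λ n → distinct-from-end end n λ i _ → straight i)
        (λ { refl → adjacent _ }) neighbours (λ i → x⇝f0 ◅◅ reach i) 0
      where
      neighbours : ∀ i {w} → f i ~ᴳ w → ∃[ j ] SymClosure (λ i j → j ≡ suc i) i j × w ≡ f j
      neighbours zero    f0~w = 1 , fwd refl , end f0~w
      neighbours (suc i) fi~w with closed i fi~w
      ... | inj₁ w≡fi   = i , bwd refl , w≡fi
      ... | inj₂ w≡f2+i = 2 + i , fwd refl , w≡f2+i

    -- At the least n where some vertex recurs, the recurring vertex is `f 0` by `return-to-start`,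
    -- and the vertices before n form a cycle. Length 1 would be a loop, length 2 a turn, length 3 a
    -- triangle.
    injective-or-cycle : MaxDegree≤2 G → ¬ Triangle G → (∀ i → f i ≢ f (2 + i)) →
      (∀ {i j} → f i ≡ f j → i ≡ j) ⊎ IsLongCycle (component G (f 0))
    injective-or-cycle degree≤2 noTriangle straight
      with lower-em v {e} em {∃[ n ] ∃[ i ] i < n × f i ≡ f n}
    ... | no ¬repeat =
      inj₁ (distinct⇒injective λ _ {i} {j} i<j _ fi≡fj → ¬repeat (j , i , i<j , fi≡fj))
    ... | yes (m , repeat)
      with least (lower-em v {e} em) (λ n → ∃[ i ] i < n × f i ≡ f n) m repeat
    ...   | n , (i , i<n , fi≡fn) , first = inj₂ (cycle-of n i<n fi≡fn distinct)
      where
      distinct : Distinct n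
      distinct {i} {j} i<j j<n fi≡fj = first j j<n (i , i<j , fi≡fj)

      cycle-of : ∀ n {i} → i < n → f i ≡ f n → Distinct n → IsLongCycle (component G (f 0))
      cycle-of n i<n fi≡fn distinct with return-to-start distinct (λ i _ → straight i) _ i<n fi≡fn
      cycle-of 1 _ f0≡f1 _ | refl = contradiction (adjacent 0) (~-irrefl G f0≡f1)
      cycle-of 2 _ f0≡f2 _ | refl = contradiction f0≡f2 (straight 0)
      cycle-of 3 _ f0≡f3 _ | refl = contradiction
        (f 0 , f 1 , f 2 , adjacent 0 , adjacent 1 ,
         ~-sym G (subst (f 2 ~ᴳ_) (sym f0≡f3) (adjacent 2))) noTriangle
      cycle-of (suc m@(suc (suc (suc _)))) _ f0≡fn distinct | refl =
        suc m , s≤s (s≤s (s≤s (s≤s z≤n))) , component-≅ (f ∘ toℕ) (distinct⇒injective-Fin distinct)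
          (λ { {i} (inj₁ j≡1+i) → subst (λ k → f (toℕ i) ~ᴳ f k) (sym j≡1+i) (adjacent (toℕ i))
             ; {i} (inj₂ (1+i≡n , j≡0)) →
                 subst (f (toℕ i) ~ᴳ_) (trans (cong f 1+i≡n) (trans (sym f0≡fn) (cong f (sym j≡0))))
                   (adjacent (toℕ i)) })
          neighbours (λ i → reach (toℕ i)) zero
        where
        last : Fin (suc m)
        last = fromℕ m

        f0~fm : f 0 ~ᴳ f m
        f0~fm = subst (_~ᴳ f m) (sym f0≡fn) (~-sym G (adjacent m))

        neighbours : (i : Fin (suc m)) → ∀ {w} → f (toℕ i) ~ᴳ w →
          ∃[ j ] SymClosure (λ i j → toℕ j ≡ suc (toℕ i) ⊎ suc (toℕ i) ≡ suc m × toℕ j ≡ 0) i j ×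
            w ≡ f (toℕ j)
        -- `closed` only speaks of later vertices; at `f 0` the two known neighbours `f 1` and `f m`
        -- exhaust the degree bound.
        neighbours zero f0~w with degree≤2 (adjacent 0) f0~fm f0~w
        ... | inj₁ f1≡fm        = contradiction f1≡fm (distinct (s≤s (s≤s z≤n)) ℕ.≤-refl)
        ... | inj₂ (inj₁ f1≡w) = suc zero , fwd (inj₁ refl) , sym f1≡w
        ... | inj₂ (inj₂ fm≡w) = last , bwd (inj₂ (cong suc (toℕ-fromℕ m) , refl)) ,
          trans (sym fm≡w) (cong f (sym (toℕ-fromℕ m)))
        neighbours (suc i) fi~w with closed (toℕ i) fi~w
        ... | inj₁ w≡fi =
          inject₁ i , bwd (inj₁ (cong suc (sym (toℕ-inject₁ i)))) ,
          trans w≡fi (cong f (sym (toℕ-inject₁ i)))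
        ... | inj₂ w≡f2+i with ℕ.m≤n⇒m<n∨m≡n (toℕ<n i)
        ...   | inj₁ 1+i<m = fromℕ< (s<s 1+i<m) , fwd (inj₁ (toℕ-fromℕ< (s<s 1+i<m))) ,
                             trans w≡f2+i (cong f (sym (toℕ-fromℕ< (s<s 1+i<m))))
        ...   | inj₂ 1+i≡m = zero , fwd (inj₂ (cong suc 1+i≡m , refl)) ,
                             trans w≡f2+i (trans (cong (f ∘ suc) 1+i≡m) (sym f0≡fn))

  two-way-path : MaxDegree≤2 G → {f g : ℕ → V G} → IsWalk f → IsWalk g →
    (∀ {i j} → f i ≡ f j → i ≡ j) → (∀ {i j} → g i ≡ g j → i ≡ j) →
    f 0 ≡ g 0 → f 1 ≢ g 1 → component G (f 0) ≅ twoWayInfinitePath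
  two-way-path degree≤2 {f} {g} f-walk g-walk f-injective g-injective f0≡g0 f1≢g1 =
    component-≅ h h-injective (λ { {i} refl → h-adjacent i }) neighbours h-reach (+ 0)
    where
    module F = IsWalk f-walk
    module G′ = IsWalk g-walk

    -- The negative integers follow `g` from `g 1` on, so that the common start `f 0 ≡ g 0` is
    -- counted once.
    h : ℤ → V G
    h (+ n)    = f n
    h -[1+ n ] = g (suc n)

    -- From a common vertex, one step back along `g` leads to another vertex of `f`, by `closed`.
    -- Descending on j, this reaches `g 0 ≡ f 0`, where injectivity of `f` leaves only `f 1 ≡ g 1`.
    disjoint : ∀ i j → f i ≢ g (suc j)
    disjoint zero j f0≡g with () ← g-injective (trans (sym f0≡g0) f0≡g)
    disjoint (suc i) zero f1+i≡g1
      with F.closed i (subst (_~ᴳ g 0) (sym f1+i≡g1) (~-sym G (G′.adjacent 0)))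
    ... | inj₂ g0≡f2+i with () ← f-injective (trans f0≡g0 g0≡f2+i)
    ... | inj₁ g0≡fi with refl ← f-injective (trans f0≡g0 g0≡fi) = f1≢g1 f1+i≡g1
    disjoint (suc i) (suc j) fi≡gj
      with F.closed i (subst (_~ᴳ g (suc j)) (sym fi≡gj) (~-sym G (G′.adjacent (suc j))))
    ... | inj₁ gj≡fi   = disjoint i j (sym gj≡fi)
    ... | inj₂ gj≡f2+i = disjoint (2 + i) j (sym gj≡f2+i)

    h-injective : ∀ {i j} → h i ≡ h j → i ≡ j
    h-injective { + m }      { + n }      fm≡fn = cong +_ (f-injective fm≡fn)
    h-injective { + m }      { -[1+ n ] } fm≡gn = contradiction fm≡gn (disjoint m n)
    h-injective { -[1+ m ] } { + n }      gm≡fn = contradiction (sym gm≡fn) (disjoint n m)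
    h-injective { -[1+ m ] } { -[1+ n ] } gm≡gn with refl ← g-injective gm≡gn = refl

    h-adjacent : ∀ i → h i ~ᴳ h (ℤ.suc i)
    h-adjacent (+ n)          = F.adjacent n
    h-adjacent -[1+ zero ]    = ~-sym G (subst (_~ᴳ g 1) (sym f0≡g0) (G′.adjacent 0))
    h-adjacent -[1+ suc n ]   = ~-sym G (G′.adjacent (suc n))

    h-reach : ∀ i → Star _~ᴳ_ (f 0) (h i)
    h-reach (+ n)    = F.reach n
    h-reach -[1+ n ] = subst (λ p → Star _~ᴳ_ p (g (suc n))) (sym f0≡g0) (G′.reach (suc n))

    neighbours : ∀ i {w} → h i ~ᴳ w → ∃[ j ] SymClosure (λ i j → j ≡ ℤ.suc i) i j × w ≡ h j
    neighbours (+ zero) f0~w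
      with degree≤2 (F.adjacent 0) (~-sym G (h-adjacent -[1+ 0 ])) f0~w
    ... | inj₁ f1≡g1        = contradiction f1≡g1 f1≢g1
    ... | inj₂ (inj₁ f1≡w) = + 1 , fwd refl , sym f1≡w
    ... | inj₂ (inj₂ g1≡w) = -[1+ 0 ] , bwd refl , sym g1≡w
    neighbours (+ suc n) fn~w with F.closed n fn~w
    ... | inj₁ w≡fn   = + n , bwd refl , w≡fn
    ... | inj₂ w≡f2+n = + (2 + n) , fwd refl , w≡f2+n
    neighbours -[1+ zero ] g1~w with G′.closed 0 g1~w
    ... | inj₁ w≡g0   = + 0 , fwd refl , trans w≡g0 (sym f0≡g0)
    ... | inj₂ w≡g2   = -[1+ 1 ] , bwd refl , w≡g2
    neighbours -[1+ suc n ] gn~w with G′.closed (suc n) gn~w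
    ... | inj₁ w≡gn   = -[1+ n ] , fwd refl , w≡gn
    ... | inj₂ w≡g2+n = -[1+ 2 + n ] , bwd refl , w≡g2+n

  module _ (degree≤2 : MaxDegree≤2 G) where

    -- The neighbour of y other than x; at an end of a path the walk turns back to x.
    onward : ∀ {x y} → x ~ᴳ y → ∃[ z ] y ~ᴳ z × (∀ {w} → y ~ᴳ w → w ≡ x ⊎ w ≡ z)
    onward {x} {y} x~y with em {∃[ z ] y ~ᴳ z × z ≢ x}
    ... | yes (z , y~z , z≢x) = z , y~z , others
      where
      others : ∀ {w} → y ~ᴳ w → w ≡ x ⊎ w ≡ z
      others y~w with degree≤2 (~-sym G x~y) y~z y~w
      ... | inj₁ x≡z        = contradiction (sym x≡z) z≢x
      ... | inj₂ (inj₁ x≡w) = inj₁ (sym x≡w)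
      ... | inj₂ (inj₂ z≡w) = inj₂ (sym z≡w)
    ... | no none = x , ~-sym G x~y , others
      where
      others : ∀ {w} → y ~ᴳ w → w ≡ x ⊎ w ≡ x
      others {w} y~w with lower-em v {e} em {w ≡ x}
      ... | yes w≡x = inj₁ w≡x
      ... | no w≢x  = contradiction (w , y~w , w≢x) none

    -- The iteration runs over directed edges, since the next vertex depends on the one just left.
    dart : ∀ {x y} → x ~ᴳ y → ℕ → ∃[ p ] ∃[ q ] p ~ᴳ q
    dart x~y zero    = _ , _ , x~y
    dart x~y (suc n) = let _ , q , p~q = dart x~y n ; z , q~z , _ = onward p~q in q , z , q~z

    walk : ∀ {x y} → x ~ᴳ y → ℕ → V G
    walk x~y n = proj₁ (dart x~y n)

    walk-isWalk : ∀ {x y} (x~y : x ~ᴳ y) → IsWalk (walk x~y)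
    walk-isWalk x~y = record
      { adjacent = λ i → proj₂ (proj₂ (dart x~y i))
      ; closed   = λ i → proj₂ (proj₂ (onward (proj₂ (proj₂ (dart x~y i)))))
      }

    -- An isolated vertex counts as an end too; `component-of-end` separates this case.
    IsEnd : V G → Set (v ⊔ e)
    IsEnd r = ∀ {p q} → r ~ᴳ p → r ~ᴳ q → p ≡ q

    -- A walk started at the end r either never turns back, giving a one-way infinite path, or its
    -- first turn marks the other end of a finite path.
    component-of-end : ∀ {x r} → Star _~ᴳ_ x r → IsEnd r →
      IsPath (component G x) ⊎ IsIsolatedVertex (component G x)
    component-of-end {x} {r} x⇝r end with em {∃[ y ] r ~ᴳ y}
    ... | no isolated = inj₂ (component-≅ {I = Fin 1} {R = λ _ _ → ⊥} (λ _ → r)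
      (λ { {zero} {zero} _ → refl }) (λ ()) (λ _ r~w → contradiction (_ , r~w) isolated)
      (λ _ → x⇝r) zero)
    ... | yes (y , r~y) with lower-em v {e} em {∃[ n ] walk r~y n ≡ walk r~y (2 + n)}
    ...   | no never = inj₁ (inj₂ (inj₁ (IsWalk.one-way-path (walk-isWalk r~y)
      (λ r~w → end r~w r~y) (λ i turn → never (i , turn)) x⇝r)))
    ...   | yes (m , turn)
      with n , turn , straight ← least (lower-em v {e} em)
             (λ n → walk r~y n ≡ walk r~y (2 + n)) m turn =
      inj₁ (inj₁ (2 + n , IsWalk.finite-path (walk-isWalk r~y)
        (λ r~w → end r~w r~y) n straight turn x⇝r))

    degree≤2⇒cycles-and-paths : ¬ Triangle G → CyclesAndPaths G
    degree≤2⇒cycles-and-paths noTriangle x with em {∃[ r ] Star _~ᴳ_ x r × IsEnd r}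
    ... | yes (r , x⇝r , end) = inj₂ (component-of-end x⇝r end)
    ... | no noEnd with em {∃[ p ] ∃[ q ] x ~ᴳ p × x ~ᴳ q × p ≢ q}
    ...   | no noFork = contradiction (x , ε , end) noEnd
      where
      end : IsEnd x
      end {p} {q} x~p x~q with lower-em v {e} em {p ≡ q}
      ... | yes p≡q = p≡q
      ... | no p≢q  = contradiction (p , q , x~p , x~q , p≢q) noFork
    ...   | yes (p , q , x~p , x~q , p≢q)
      with walk-isWalk x~p | walk-isWalk x~q
    ...     | f-walk | g-walk
      with IsWalk.injective-or-cycle f-walk degree≤2 noTriangle (straight x~p)
         | IsWalk.injective-or-cycle g-walk degree≤2 noTriangle (straight x~q)
      where
      -- A turn would make the vertex where it happens an end of the component.
      straight : ∀ {y} (x~y : x ~ᴳ y) i → walk x~y i ≢ walk x~y (2 + i)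
      straight x~y i turn = noEnd (walk x~y (suc i) , IsWalk.reach w (suc i) , end)
        where
        w : IsWalk (walk x~y)
        w = walk-isWalk x~y

        back : ∀ {p} → walk x~y (suc i) ~ᴳ p → p ≡ walk x~y i
        back fi~p with IsWalk.closed w i fi~p
        ... | inj₁ p≡fi   = p≡fi
        ... | inj₂ p≡f2+i = trans p≡f2+i (sym turn)

        end : IsEnd (walk x~y (suc i))
        end fi~p fi~q = trans (back fi~p) (sym (back fi~q))
    ...       | inj₂ isCycle     | _                = inj₁ isCycle
    ...       | inj₁ _           | inj₂ isCycle     = inj₁ isCycle
    ...       | inj₁ f-injective | inj₁ g-injective = inj₂ (inj₁ (inj₂ (inj₂
      (two-way-path degree≤2 f-walk g-walk f-injective g-injective refl p≢q))))

triangle-free⇒cycles-and-paths : ExcludedMiddle (v ⊔ e) → (G : Graph v e) →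
  ¬ Triangle G → Clean G → CyclesAndPaths G
triangle-free⇒cycles-and-paths em G noTriangle clean =
  degree≤2⇒cycles-and-paths em G (clean⇒degree≤2 em G noTriangle clean) noTriangle

-- Converse for cycles and paths

degree≤2∧triangle-free⇒clean : (G : Graph v e) → MaxDegree≤2 G → ¬ Triangle G → Clean G
degree≤2∧triangle-free⇒clean G degree≤2 noTriangle = noClaw , noCoclaw
  where
  noClaw : ¬ Tripod (Related G) adj non
  noClaw (tripod (_ , _ , edge px , _ , edge py , gap x≢y _ ,
    _ , edge pz , gap x≢z _ , gap y≢z _)) = [ x≢y , [ x≢z , y≢z ]′ ]′ (degree≤2 px py pz)

  noCoclaw : ¬ Tripod (Related G) non adj
  noCoclaw (tripod (_ , x , _ , y , _ , edge xy , z , _ , edge xz , edge yz)) =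
    noTriangle (x , y , z , xy , yz , xz)

-- Unlike `Clean`, this condition passes from the components to the whole graph: the neighbours of a
-- vertex, and the vertices of a triangle, lie in one component, whereas a triangle and an isolated
-- vertex form the complement of a claw.
record LinearShape (G : Graph v e) : Set (v ⊔ e) where
  constructor linear
  field
    degree≤2      : MaxDegree≤2 G
    triangle-free : ¬ Triangle G

linear-≅ : {F : Graph v e} {G : Graph v′ e′} → F ≅ G → LinearShape G → LinearShape F
linear-≅ {F = F} {G = G} (i , adjacent) (linear degree≤2 triangle-free) = linear
  (λ x~p x~q x~r → Sum.map injective (Sum.map injective injective)
    (degree≤2 (preserve x~p) (preserve x~q) (preserve x~r)))
  (λ (_ , _ , _ , x~y , y~z , x~z) → triangle-free
    (_ , _ , _ , preserve x~y , preserve y~z , preserve x~z))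
  where
  open Injection (↔⇒↣ i) using (injective)
  preserve : ∀ {x y} → _~_ F x y → _~_ G (Inverse.to i x) (Inverse.to i y)
  preserve = Equivalence.to (adjacent _ _)

linear-components : (G : Graph v e) → (∀ x → LinearShape (component G x)) → LinearShape G
linear-components G shape = linear
  (λ {x} x~p x~q x~r → Sum.map (cong value) (Sum.map (cong value) (cong value))
    (LinearShape.degree≤2 (shape x) {x , irr ε}
      {_ , irr (x~p ◅ ε)} {_ , irr (x~q ◅ ε)} {_ , irr (x~r ◅ ε)} x~p x~q x~r))
  (λ (x , y , z , x~y , y~z , x~z) → LinearShape.triangle-free (shape x)
    ((x , irr ε) , (y , irr (x~y ◅ ε)) , (z , irr (x~z ◅ ε)) , x~y , y~z , x~z))

-- `R` orients the edges with in-degree and out-degree at most one. Of three edges at a vertex, two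
-- point the same way; a triangle is either a directed cycle or has a vertex with two edges pointing
-- the same way.
simple-linear : {A : Set} (R : Rel A 0ℓ) → (∀ {x y z} → R x y → R x z → y ≡ z) →
  (∀ {x y z} → R x z → R y z → x ≡ y) → (∀ {x y z} → R x y → R y z → ¬ R z x) →
  LinearShape (simple R)
simple-linear R functional injective acyclic = linear degree≤2 triangle-free
  where
  degree≤2 : MaxDegree≤2 (simple R)
  degree≤2 (_ , fwd xp) (_ , fwd xq) _            = inj₁ (functional xp xq)
  degree≤2 (_ , bwd px) (_ , bwd qx) _            = inj₁ (injective px qx)
  degree≤2 (_ , fwd xp) (_ , bwd qx) (_ , fwd xr) = inj₂ (inj₁ (functional xp xr))
  degree≤2 (_ , fwd xp) (_ , bwd qx) (_ , bwd rx) = inj₂ (inj₂ (injective qx rx))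
  degree≤2 (_ , bwd px) (_ , fwd xq) (_ , fwd xr) = inj₂ (inj₂ (functional xq xr))
  degree≤2 (_ , bwd px) (_ , fwd xq) (_ , bwd rx) = inj₂ (inj₁ (injective px rx))

  triangle-free : ¬ Triangle (simple R)
  triangle-free (_ , _ , _ , (_ , fwd xy) , (y≢z , _) , (_ , fwd xz))     = y≢z (functional xy xz)
  triangle-free (_ , _ , _ , (_ , bwd yx) , (y≢z , _) , (_ , bwd zx))     = y≢z (injective yx zx)
  triangle-free (_ , _ , _ , (_ , fwd xy) , (_ , fwd yz) , (_ , bwd zx))  = acyclic xy yz zx
  triangle-free (_ , _ , _ , (_ , fwd xy) , (_ , bwd zy) , (x≢z , _))     = x≢z (injective xy zy)
  triangle-free (_ , _ , _ , (_ , bwd yx) , (_ , fwd yz) , (x≢z , _))     = x≢z (functional yx yz)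
  triangle-free (_ , _ , _ , (_ , bwd yx) , (_ , bwd zy) , (_ , fwd xz))  = acyclic zy yx xz

finitePath-linear : ∀ n → LinearShape (finitePath n)
finitePath-linear n = simple-linear _
  (λ xy xz → toℕ-injective (trans xy (sym xz)))
  (λ xz yz → toℕ-injective (ℕ.suc-injective (trans (sym xz) yz)))
  (λ xy yz zx → ℕ.m≢1+n+m _ (trans zx (cong suc (trans yz (cong suc xy)))))

oneWayInfinitePath-linear : LinearShape oneWayInfinitePath
oneWayInfinitePath-linear = simple-linear _
  (λ xy xz → trans xy (sym xz)) (λ xz yz → ℕ.suc-injective (trans (sym xz) yz))
  (λ { refl refl () })

twoWayInfinitePath-linear : LinearShape twoWayInfinitePath
twoWayInfinitePath-linear = simple-linear _
  (λ xy xz → trans xy (sym xz)) (λ { {x} {y} xz yz →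
    trans (sym (ℤ.pred-suc x)) (trans (cong ℤ.pred (trans (sym xz) yz)) (ℤ.pred-suc y)) })
  (λ { {x} refl refl → acyclic x })
  where
  acyclic : ∀ i → i ≢ ℤ.suc (ℤ.suc (ℤ.suc i))
  acyclic (+ n)                           ()
  acyclic -[1+ 0 ]                        ()
  acyclic -[1+ 1 ]                        ()
  acyclic -[1+ 2 ]                        ()
  acyclic -[1+ suc (suc (suc n)) ]        ()

cycle-linear : ∀ {n} → 4 ≤ n → LinearShape (cycle n)
cycle-linear {n} 4≤n = simple-linear _ functional injective acyclic
  where
  Next : Rel (Fin n) 0ℓ
  Next i j = toℕ j ≡ suc (toℕ i) ⊎ suc (toℕ i) ≡ n × toℕ j ≡ 0

  not-last : ∀ {i j : Fin n} → toℕ j ≡ suc (toℕ i) → suc (toℕ i) ≢ n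
  not-last {i} {j} j≡1+i 1+i≡n = ℕ.<⇒≢ (toℕ<n j) (trans j≡1+i 1+i≡n)

  functional : ∀ {x y z} → Next x y → Next x z → y ≡ z
  functional (inj₁ xy)          (inj₁ xz)          = toℕ-injective (trans xy (sym xz))
  functional (inj₁ xy)          (inj₂ (last , _))  = contradiction last (not-last xy)
  functional (inj₂ (last , _))  (inj₁ xz)          = contradiction last (not-last xz)
  functional (inj₂ (_ , y≡0))   (inj₂ (_ , z≡0))   = toℕ-injective (trans y≡0 (sym z≡0))

  injective : ∀ {x y z} → Next x z → Next y z → x ≡ y
  injective (inj₁ xz)         (inj₁ yz)         =
    toℕ-injective (ℕ.suc-injective (trans (sym xz) yz))
  injective (inj₁ xz)         (inj₂ (_ , z≡0))  with () ← trans (sym xz) z≡0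
  injective (inj₂ (_ , z≡0))  (inj₁ yz)         with () ← trans (sym yz) z≡0
  injective (inj₂ (x≡l , _))  (inj₂ (y≡l , _))  =
    toℕ-injective (ℕ.suc-injective (trans x≡l (sym y≡l)))

  -- A directed triangle using the closing arc from the last vertex to 0 forces n to be 3, 2 or 1 in
  -- the three cases; `acyclic` rotates any such triangle into this position.
  wrapped : ∀ {x y z} → suc (toℕ x) ≡ n → toℕ y ≡ 0 → Next y z → ¬ Next z x
  wrapped x≡l y≡0 (inj₁ z≡1+y) (inj₁ x≡1+z) = ℕ.<⇒≢ 4≤n (sym (trans (sym x≡l)
    (cong suc (trans x≡1+z (cong suc (trans z≡1+y (cong suc y≡0)))))))
  wrapped x≡l y≡0 (inj₁ z≡1+y) (inj₂ (z≡l , _)) = ℕ.<⇒≢ (ℕ.<-trans (ℕ.n<1+n 2) 4≤n)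
    (sym (trans (sym z≡l) (cong suc (trans z≡1+y (cong suc y≡0)))))
  wrapped x≡l y≡0 (inj₂ (y≡l , _)) _ = ℕ.<⇒≢ (ℕ.≤-trans (s≤s (s≤s z≤n)) 4≤n)
    (sym (trans (sym y≡l) (cong suc y≡0)))

  acyclic : ∀ {x y z} → Next x y → Next y z → ¬ Next z x
  acyclic (inj₁ xy)         (inj₁ yz)         (inj₁ zx) =
    ℕ.m≢1+n+m _ (trans zx (cong suc (trans yz (cong suc xy))))
  acyclic (inj₂ (x≡l , y≡0)) yz zx = wrapped x≡l y≡0 yz zx
  acyclic xy (inj₂ (y≡l , z≡0)) zx = wrapped y≡l z≡0 zx xy
  acyclic xy yz (inj₂ (z≡l , x≡0)) = wrapped z≡l x≡0 xy yz

cyclesAndPaths⇒clean : {G : Graph v e} → CyclesAndPaths G → Clean G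
cyclesAndPaths⇒clean {G = G} shape = degree≤2∧triangle-free⇒clean G degree≤2 triangle-free
  where
  component-linear : ∀ x → LinearShape (component G x)
  component-linear x with shape x
  ... | inj₁ (n , 4≤n , ≅cycle)           = linear-≅ ≅cycle (cycle-linear 4≤n)
  ... | inj₂ (inj₁ (inj₁ (n , ≅path)))    = linear-≅ ≅path (finitePath-linear n)
  ... | inj₂ (inj₁ (inj₂ (inj₁ ≅ray)))    = linear-≅ ≅ray oneWayInfinitePath-linear
  ... | inj₂ (inj₁ (inj₂ (inj₂ ≅line)))   = linear-≅ ≅line twoWayInfinitePath-linear
  ... | inj₂ (inj₂ ≅vertex)               =
    linear-≅ ≅vertex (simple-linear (λ _ _ → ⊥) (λ ()) (λ ()) (λ ()))

  open LinearShape (linear-components G component-linear)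

-- Finite labelled graphs

-- A triangular table: each row lists the kinds of a new vertex to the earlier ones. Symmetry is
-- built in, and adding a vertex adds one row. The newest vertex has index 0.
data Config : ℕ → Set where
  []  : Config 0
  _▹_ : Config n → Vec Kind n → Config (suc n)

infixl 5 _▹_

kind : Config n → Fin n → Fin n → Kind
kind (M ▹ r) zero    zero    = eq
kind (M ▹ r) zero    (suc j) = lookup r j
kind (M ▹ r) (suc i) zero    = lookup r i
kind (M ▹ r) (suc i) (suc j) = kind M i j

config : ∀ {A : Set} → (A → A → Kind) → Vec A n → Config n
config κ []       = []
config κ (x ∷ xs) = config κ xs ▹ map (κ x) xs

Labels : ∀ {i} {I : Set i} (G : Graph v e) → (I → I → Kind) → (I → V G) → Set (v ⊔ e ⊔ i)
Labels G κ f = ∀ i j → Related G (f i) (f j) (κ i j)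

record Realises (G : Graph v e) (M : Config n) (xs : Vec (V G) n) : Set (v ⊔ e) where
  constructor realises
  field labels : Labels G (kind M) (lookup xs)

open Realises

realises-[] : {G : Graph v e} → Realises G [] []
realises-[] = realises λ ()

realises-▹ : {G : Graph v e} {M : Config n} {xs : Vec (V G) n} {w : V G} {r : Vec Kind n} →
  Realises G M xs → Pointwise (Related G w) xs r → Realises G (M ▹ r) (w ∷ xs)
realises-▹ {G = G} {M} {xs} {w} {r} real row = realises extended
  where
  extended : Labels G (kind (M ▹ r)) (lookup (w ∷ xs))
  extended zero    zero    = same refl
  extended zero    (suc j) = Pointwise.lookup row j
  extended (suc i) zero    = related-sym (Pointwise.lookup row i)
  extended (suc i) (suc j) = labels real i j

row : {G : Graph v e} → Trichotomous G → (w : V G) (xs : Vec (V G) n) →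
  Σ[ r ∈ Vec Kind n ] Pointwise (Related G w) xs r
row tri w []       = [] , []
row tri w (x ∷ xs) = let k , s = tri w x ; r , rs = row tri w xs in k ∷ r , s ∷ rs

Surjective : ∀ {i ℓ} {I : Set i} {A : Set ℓ} → (I → A) → Set (i ⊔ ℓ)
Surjective f = ∀ y → ∃[ i ] f i ≡ y

module _ {F : Graph v e} {κ : Fin n → Fin n → Kind} {f : Fin n → V F}
  (labels : Labels F κ f) (surjective : Surjective f) where

  private
    index : V F → Fin n
    index = proj₁ ∘ surjective

    related : ∀ x y → Related F x y (κ (index x) (index y))
    related x y with i , refl ← surjective x with j , refl ← surjective y = labels i j

  labels⇒trichotomous : Trichotomous F
  labels⇒trichotomous x y = _ , related x y

  labels⇒↪ : {G : Graph v′ e′} {g : Fin n → V G} → Labels G κ g → F ↪ G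
  labels⇒↪ {G = G} {g} labels′ = g ∘ index , λ {x} {y} r →
    subst (Related G _ _) (related-unique (related x y) r) (labels′ (index x) (index y))

  labels⇒≅ : {G : Graph v′ e′} {g : Fin n → V G} → Labels G κ g → Surjective g → G ≅ F
  labels⇒≅ {G = G} {g} labels′ surjective′ = ≅-sym {F = F} {G = G}
    (surjective-embedding⇒≅ {F = F} {G = G} (g ∘ index) (f ∘ proj₁ ∘ surjective′) g∘index
      (↪-injective {F = F} {G = G} labels⇒trichotomous F↪G)
      (↪-adjacent {F = F} {G = G} labels⇒trichotomous F↪G))
    where
    F↪G : F ↪ G
    F↪G = labels⇒↪ {G = G} labels′

    g∘index : ∀ w → g (index (f (proj₁ (surjective′ w)))) ≡ w
    -- `surjective` may return another index j of the same vertex `f i`; then `κ j i` is `eq`, and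
    -- so `g` identifies j and i as well.
    g∘index w with i , refl ← surjective′ w with j , fj≡fi ← surjective (f i)
      with labels′ j i | related-unique (labels j i) (same fj≡fi)
    ... | r | κ≡eq with same gj≡gi ← subst (Related G _ _) κ≡eq r = gj≡gi

  tripod-index : ∀ {s t} → Tripod (Related F) s t → Tripod (λ i j k → κ i j ≡ k) s t
  tripod-index = map-tripod index (related-unique (related _ _)) (related-unique (related _ _))

module _ (κ : Fin n → Fin n → Kind) where

  KindTripod : Kind → Kind → Set
  KindTripod = Tripod (λ i j k → κ i j ≡ k)

  Inconsistent : Set
  Inconsistent = ∃[ i ] ∃[ j ] κ i j ≡ eq × ∃[ k ] κ i k ≢ κ j k

  -- Decidable reasons why a table cannot be realised in a clean graph. `inconsistent` discards rows
  -- that declare two vertices equal but relate them differently to a third, so that enumerations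
  -- may include entries `eq`.
  data Obstructed : Set where
    claw         : KindTripod adj non → Obstructed
    coclaw       : KindTripod non adj → Obstructed
    inconsistent : Inconsistent → Obstructed

  tripod? : ∀ s t → Dec (KindTripod s t)
  tripod? s t = map′ tripod Tripod.foot-and-ends
    (any? λ p → any? λ x → (κ p x ≟ᵏ s) ×-dec any? λ y → (κ p y ≟ᵏ s) ×-dec (κ x y ≟ᵏ t) ×-dec
      any? λ z → (κ p z ≟ᵏ s) ×-dec (κ x z ≟ᵏ t) ×-dec (κ y z ≟ᵏ t))

  obstructed? : Dec Obstructed
  obstructed? = map′ [ claw , [ coclaw , inconsistent ]′ ]′
    (λ { (claw t) → inj₁ t ; (coclaw t) → inj₂ (inj₁ t) ; (inconsistent t) → inj₂ (inj₂ t) })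
    (tripod? adj non ⊎-dec tripod? non adj ⊎-dec
      any? λ i → any? λ j → (κ i j ≟ᵏ eq) ×-dec any? λ k → ¬? (κ i k ≟ᵏ κ j k))

clean⇒¬obstructed : {G : Graph v e} {κ : Fin n → Fin n → Kind} {f : Fin n → V G} →
  Clean G → Labels G κ f → ¬ Obstructed κ
clean⇒¬obstructed {G = G} {κ} {f} (noClaw , noCoclaw) labels =
  λ { (claw t)         → noClaw (lift-tripod t)
    ; (coclaw t)       → noCoclaw (lift-tripod t)
    ; (inconsistent t) → consistent t }
  where
  lift-tripod : ∀ {s t} → KindTripod κ s t → Tripod (Related G) s t
  lift-tripod = map-tripod f (λ { refl → labels _ _ }) (λ { refl → labels _ _ })

  consistent : ¬ Inconsistent κ
  consistent (i , j , κ≡eq , k , κik≢κjk) with labels i j | labels i k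
  ... | ij | ik with same fi≡fj ← subst (Related G (f i) (f j)) κ≡eq ij =
    κik≢κjk (related-unique ik (subst (λ x → Related G x (f k) (κ j k)) (sym fi≡fj) (labels j k)))

every-kind? : ∀ {ℓ} {P : Kind → Set ℓ} → Decidable P → Dec (∀ k → P k)
every-kind? P? = map′ (λ { (p , q , r) → λ { eq → p ; adj → q ; non → r } })
  (λ p → p eq , p adj , p non) (P? eq ×-dec P? adj ×-dec P? non)

every-row? : ∀ {ℓ} {P : Vec Kind n → Set ℓ} → Decidable P → Dec (∀ r → P r)
every-row? {zero} P? = map′ (λ { p [] → p }) (λ p → p []) (P? [])
every-row? {suc n} P? = map′ (λ { p (k ∷ r) → p k r }) (λ p k r → p (k ∷ r))
  (every-kind? λ k → every-row? λ r → P? (k ∷ r))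

_≟ʳ_ : (r s : Vec Kind n) → Dec (r ≡ s)
_≟ʳ_ = ≡-dec _≟ᵏ_

-- The index 3i + j stands for the vertex `(i , j)`.
grid : Fin 9 → V P₉
grid = remQuot {3} 3

P₉-kind : V P₉ → V P₉ → Kind
P₉-kind (i , j) (k , l) with i ≟ k | j ≟ l
... | yes _ | yes _ = eq
... | yes _ | no _  = adj
... | no _  | yes _ = adj
... | no _  | no _  = non

P₉-related : ∀ p q → Related P₉ p q (P₉-kind p q)
P₉-related (i , j) (k , l) with i ≟ k | j ≟ l
... | yes refl | yes refl = same refl
... | yes i≡k  | no j≢l   = edge (inj₁ (i≡k , j≢l))
... | no i≢k   | yes j≡l  = edge (inj₂ (i≢k , j≡l))
... | no i≢k   | no j≢l   = gap (i≢k ∘ cong proj₁)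
  λ { (inj₁ (i≡k , _)) → i≢k i≡k ; (inj₂ (_ , j≡l)) → j≢l j≡l }

grid-kind : Fin 9 → Fin 9 → Kind
grid-kind p q = P₉-kind (grid p) (grid q)

-- The corners p, b, c, y, z of a bull: the triangle p b c with pendant edges b y and c z.
bull-corners : Vec (Fin 9) 5
bull-corners = 0F ∷ 1F ∷ 2F ∷ 4F ∷ 8F ∷ []

bull : Config 5
bull = config grid-kind bull-corners

grid-row : Fin 9 → Vec Kind 5
grid-row p = map (grid-kind p) bull-corners

-- Entries are in the order p, b, c, y, z. In the sun the new vertex completes a central triangle
-- with b and c, bounded by triangles with tips p, y and z; in the net it is a third pendant vertex,
-- at p.
sun-row net-row : Vec Kind 5
sun-row = non ∷ adj ∷ adj ∷ adj ∷ adj ∷ []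
net-row = adj ∷ non ∷ non ∷ non ∷ non ∷ []

sun net : Config 6
sun = bull ▹ sun-row
net = bull ▹ net-row

abstract

  -- Evaluation of all 243 rows. The grid rows include those of the five corners themselves, which
  -- covers vertices already in the bull.
  bull-extensions : ∀ r →
    Obstructed (kind (bull ▹ r)) ⊎ r ≡ sun-row ⊎ r ≡ net-row ⊎ ∃[ p ] r ≡ grid-row p
  bull-extensions = from-yes (every-row? λ r → obstructed? (kind (bull ▹ r)) ⊎-dec
    (r ≟ʳ sun-row) ⊎-dec (r ≟ʳ net-row) ⊎-dec any? λ p → r ≟ʳ grid-row p)

  -- The case p = q is included and forces `eq`, so distinct vertices get distinct positions.
  grid-extensions : ∀ p q k →
    k ≡ grid-kind q p ⊎ Obstructed (kind (bull ▹ grid-row p ▹ (k ∷ grid-row q)))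
  grid-extensions = from-yes (all? λ p → all? λ q → every-kind? λ k →
    (k ≟ᵏ grid-kind q p) ⊎-dec obstructed? (kind (bull ▹ grid-row p ▹ (k ∷ grid-row q))))

  sun-extensions : ∀ r → Any (eq ≡_) r ⊎ Obstructed (kind (sun ▹ r))
  sun-extensions = from-yes (every-row? λ r →
    Any.any? (eq ≟ᵏ_) r ⊎-dec obstructed? (kind (sun ▹ r)))

  net-extensions : ∀ r → Any (eq ≡_) r ⊎ Obstructed (kind (net ▹ r))
  net-extensions = from-yes (every-row? λ r →
    Any.any? (eq ≟ᵏ_) r ⊎-dec obstructed? (kind (net ▹ r)))

  grid-tripod-free : ¬ KindTripod grid-kind adj non × ¬ KindTripod grid-kind non adj
  grid-tripod-free = from-yes (¬? (tripod? grid-kind adj non) ×-dec ¬? (tripod? grid-kind non adj))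

  sun-tripod-free : ¬ KindTripod (kind sun) adj non × ¬ KindTripod (kind sun) non adj
  sun-tripod-free = from-yes (¬? (tripod? (kind sun) adj non) ×-dec ¬? (tripod? (kind sun) non adj))

-- The graphs A₆ and P₉, and extensions of the bull

-- Listed in the order of `sun`: a is the vertex added to the bull, and a′, b, c, c′, b′ are its
-- corners p, b, c, y, z.
sun-vertices : Vec A₆Vertex 6
sun-vertices = a ∷ a′ ∷ b ∷ c ∷ c′ ∷ b′ ∷ []

A₆-sun : Realises A₆ sun sun-vertices
A₆-sun = realises-▹ (realises-▹ (realises-▹ (realises-▹ (realises-▹ (realises-▹ realises-[] [])
  (nonedge (λ ()) (λ ()) (λ ()) ∷ []))
  (nonedge (λ ()) (λ ()) (λ ()) ∷ edge⁻¹ b′c ∷ []))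
  (edge⁺ bc ∷ edge⁻¹ c′b ∷ nonedge (λ ()) (λ ()) (λ ()) ∷ []))
  (edge⁺ a′b ∷ edge⁺ a′c ∷ nonedge (λ ()) (λ ()) (λ ()) ∷ nonedge (λ ()) (λ ()) (λ ()) ∷ []))
  (nonedge (λ ()) (λ ()) (λ ()) ∷ edge⁺ ab ∷ edge⁻¹ ca ∷ edge⁻¹ c′a ∷ edge⁻¹ b′a ∷ [])
  where
  irreflexive : ∀ {x} → ¬ A₆Edge x x
  irreflexive ()

  edge⁺ : ∀ {x y} → A₆Edge x y → Related A₆ x y adj
  edge⁺ xy = edge ((λ { refl → irreflexive xy }) , fwd xy)

  edge⁻¹ : ∀ {x y} → A₆Edge x y → Related A₆ y x adj
  edge⁻¹ xy = related-sym (edge⁺ xy)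

  nonedge : ∀ {x y} → x ≢ y → ¬ A₆Edge x y → ¬ A₆Edge y x → Related A₆ x y non
  nonedge x≢y ¬xy ¬yx = gap x≢y λ { (_ , fwd xy) → ¬xy xy ; (_ , bwd yx) → ¬yx yx }

sun-vertices-surjective : Surjective (lookup sun-vertices)
sun-vertices-surjective a  = 0F , refl
sun-vertices-surjective a′ = 1F , refl
sun-vertices-surjective b  = 2F , refl
sun-vertices-surjective c  = 3F , refl
sun-vertices-surjective c′ = 4F , refl
sun-vertices-surjective b′ = 5F , refl

-- An anti-isomorphism from the net onto the sun.
net⇒sun : Fin 6 → Fin 6
net⇒sun = lookup (0F ∷ 1F ∷ 5F ∷ 4F ∷ 2F ∷ 3F ∷ [])

net-dual : ∀ i j → kind sun (net⇒sun i) (net⇒sun j) ≡ dual (kind net i j)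
net-dual = from-yes (all? λ i → all? λ j → kind sun (net⇒sun i) (net⇒sun j) ≟ᵏ dual (kind net i j))

net⇒sun-surjective : Surjective net⇒sun
net⇒sun-surjective = from-yes (all? λ j → any? λ i → net⇒sun i ≟ j)

A₆-clean : Clean A₆
A₆-clean = let noClaw , noCoclaw = sun-tripod-free in
  noClaw ∘ tripod-index (labels A₆-sun) sun-vertices-surjective ,
  noCoclaw ∘ tripod-index (labels A₆-sun) sun-vertices-surjective

grid-labels : Labels P₉ grid-kind grid
grid-labels p q = P₉-related (grid p) (grid q)

grid-surjective : Surjective grid
grid-surjective (i , j) = combine i j , remQuot-combine i j

P₉-clean : Clean P₉
P₉-clean = let noClaw , noCoclaw = grid-tripod-free in
  noClaw ∘ tripod-index grid-labels grid-surjective ,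
  noCoclaw ∘ tripod-index grid-labels grid-surjective

listed⇒clean : {G : Graph v e} → Listed G → Clean G
listed⇒clean {G = G} (inj₁ ≅A₆) = clean-↪ {F = G} {G = A₆} (≅⇒↪ ≅A₆) A₆-clean
listed⇒clean {G = G} (inj₂ (inj₁ ≤P₉)) =
  clean-↪ {F = G} {G = P₉} (≤ᵢ⇒↪ {F = G} {G = P₉} ≤P₉) P₉-clean
listed⇒clean {G = G} (inj₂ (inj₂ shape)) = cyclesAndPaths⇒clean {G = G} shape

-- A triangle p b c and an independent triple p y z; the row lists the kinds of
-- b y, b z, c y and c z.
meeting-config : Vec Kind 4 → Config 5
meeting-config (by ∷ bz ∷ cy ∷ cz ∷ []) =
  [] ▹ [] ▹ (non ∷ []) ▹ (cy ∷ cz ∷ []) ▹ (adj ∷ by ∷ bz ∷ []) ▹ (adj ∷ adj ∷ non ∷ non ∷ [])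

abstract

  -- Evaluation of all 81 rows. In the two surviving ones b and c are matched with y and z;
  -- exchanging b and c turns one into the other, so both are bulls.
  meeting-cases : ∀ r → Obstructed (kind (meeting-config r)) ⊎
    r ≡ adj ∷ non ∷ non ∷ adj ∷ [] ⊎ r ≡ non ∷ adj ∷ adj ∷ non ∷ []
  meeting-cases = from-yes (every-row? λ r → obstructed? (kind (meeting-config r)) ⊎-dec
    (r ≟ʳ (adj ∷ non ∷ non ∷ adj ∷ [])) ⊎-dec (r ≟ʳ (non ∷ adj ∷ adj ∷ non ∷ [])))

-- Clean graphs with a triangle and an independent triple

module _ {G : Graph v e} (tri : Trichotomous G) (clean : Clean G) where

  private
    Bull : Set (v ⊔ e)
    Bull = Σ[ xs ∈ Vec (V G) 5 ] Realises G bull xs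

    R : V G → V G → Kind → Set (v ⊔ e)
    R = Related G

  realised⇒¬obstructed : {M : Config n} {xs : Vec (V G) n} →
    Realises G M xs → ¬ Obstructed (kind M)
  realised⇒¬obstructed real = clean⇒¬obstructed clean (labels real)

  meeting⇒bull : ∀ {p q r y z} → R p q adj → R p r adj → R q r adj →
    R p y non → R p z non → R y z non → Bull
  meeting⇒bull {p} {q} {r} {y} {z} pq pr qr py pz yz =
    let _ , qy = tri q y ; _ , qz = tri q z ; _ , ry = tri r y ; _ , rz = tri r z
    in split qy qz ry rz (meeting-cases _)
    where
    meeting : ∀ {q r qy qz ry rz} → R p q adj → R p r adj → R q r adj →
      R q y qy → R q z qz → R r y ry → R r z rz →
      Realises G (meeting-config (qy ∷ qz ∷ ry ∷ rz ∷ [])) (p ∷ q ∷ r ∷ y ∷ z ∷ [])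
    meeting pq pr qr qy qz ry rz =
      realises-▹ (realises-▹ (realises-▹ (realises-▹ (realises-▹ realises-[] [])
        (yz ∷ [])) (ry ∷ rz ∷ [])) (qr ∷ qy ∷ qz ∷ [])) (pq ∷ pr ∷ py ∷ pz ∷ [])

    split : ∀ {k l m n} → R q y k → R q z l → R r y m → R r z n →
      Obstructed (kind (meeting-config (k ∷ l ∷ m ∷ n ∷ []))) ⊎
      k ∷ l ∷ m ∷ n ∷ [] ≡ adj ∷ non ∷ non ∷ adj ∷ [] ⊎
      k ∷ l ∷ m ∷ n ∷ [] ≡ non ∷ adj ∷ adj ∷ non ∷ [] → Bull
    split qy qz ry rz (inj₁ obstructed) =
      contradiction obstructed (realised⇒¬obstructed (meeting pq pr qr qy qz ry rz))
    split qy qz ry rz (inj₂ (inj₁ refl)) = _ , meeting pq pr qr qy qz ry rz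
    split qy qz ry rz (inj₂ (inj₂ refl)) = _ , meeting pr pq (related-sym qr) ry rz qy qz

  -- The third vertex z serves the cases where p is x or y itself: the other two vertices of the
  -- triple are then taken.
  two-gaps : ∀ {p x y z} → R x y non → R x z non → R y z non →
    ¬ R p x adj → ¬ R p y adj → ∃[ s ] ∃[ t ] R p s non × R p t non × R s t non
  two-gaps {p} {x} {y} xy xz yz p≁x p≁y with tri p x | tri p y
  ... | _ , same refl    | _                = _ , _ , xy , xz , yz
  ... | _ , px@(edge _)  | _                = contradiction px p≁x
  ... | _ , gap _ _      | _ , same refl    = _ , _ , related-sym xy , yz , xz
  ... | _ , gap _ _      | _ , py@(edge _)  = contradiction py p≁y
  ... | _ , px@(gap _ _) | _ , py@(gap _ _) = _ , _ , px , py , xy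

  adjacent? : ∀ x y → Dec (R x y adj)
  adjacent? x y with tri x y
  ... | _ , same x≡y     = no λ { (edge x~y) → ~-irrefl G x≡y x~y }
  ... | _ , xy@(edge _)  = yes xy
  ... | _ , gap _ x≁y    = no λ { (edge x~y) → x≁y x~y }

  -- If p and q have no common neighbour in the independent triple x y z, one of them
  -- misses two vertices of the triple.
  triangle∧independent⇒bull : ∀ {p q r x y z} → R p q adj → R p r adj → R q r adj →
    R x y non → R x z non → R y z non → Bull
  triangle∧independent⇒bull {p} {q} {r} {x} {y} {z} pq pr qr xy xz yz =
    split (common x) (common y) (common z)
    where
    Common : V G → Set (v ⊔ e)
    Common s = (R p s adj × R q s adj) ⊎ ¬ R p s adj ⊎ ¬ R q s adj

    common : ∀ s → Common s
    common s with adjacent? p s | adjacent? q s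
    ... | yes ps | yes qs = inj₁ (ps , qs)
    ... | no p≁s | _      = inj₂ (inj₁ p≁s)
    ... | yes _  | no q≁s = inj₂ (inj₂ q≁s)

    yx = related-sym xy
    zx = related-sym xz
    zy = related-sym yz

    at-p : (∃[ s ] ∃[ t ] R p s non × R p t non × R s t non) → Bull
    at-p (_ , _ , ps , pt , st) = meeting⇒bull pq pr qr ps pt st

    at-q : (∃[ s ] ∃[ t ] R q s non × R q t non × R s t non) → Bull
    at-q (_ , _ , qs , qt , st) = meeting⇒bull (related-sym pq) qr pr qs qt st

    at-common : ∀ {s t u} → R p s adj → R q s adj → R s t non → R s u non → R t u non → Bull
    at-common ps qs st su tu = meeting⇒bull (related-sym ps) (related-sym qs) pq st su tu

    split : Common x → Common y → Common z → Bull
    split (inj₁ (px , qx)) _ _ = at-common px qx xy xz yz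
    split _ (inj₁ (py , qy)) _ = at-common py qy yx yz xz
    split _ _ (inj₁ (pz , qz)) = at-common pz qz zx zy xy
    split (inj₂ (inj₁ px)) (inj₂ (inj₁ py)) _ = at-p (two-gaps xy xz yz px py)
    split (inj₂ (inj₂ qx)) (inj₂ (inj₂ qy)) _ = at-q (two-gaps xy xz yz qx qy)
    split (inj₂ (inj₁ px)) (inj₂ (inj₂ _)) (inj₂ (inj₁ pz)) = at-p (two-gaps xz xy zy px pz)
    split (inj₂ (inj₁ _)) (inj₂ (inj₂ qy)) (inj₂ (inj₂ qz)) = at-q (two-gaps yz yx zx qy qz)
    split (inj₂ (inj₂ _)) (inj₂ (inj₁ py)) (inj₂ (inj₁ pz)) = at-p (two-gaps yz yx zx py pz)
    split (inj₂ (inj₂ qx)) (inj₂ (inj₁ _)) (inj₂ (inj₂ qz)) = at-q (two-gaps xz xy zy qx qz)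

  -- The row of any vertex w is unobstructed because `G` is clean, so it has an entry `eq`, which
  -- locates w on the list.
  saturated⇒surjective : (M : Config n) → (∀ r → Any (eq ≡_) r ⊎ Obstructed (kind (M ▹ r))) →
    ∀ {xs} → Realises G M xs → Surjective (lookup xs)
  saturated⇒surjective M saturated {xs} real w with r , rs ← row tri w xs with saturated r
  ... | inj₂ obstructed = contradiction obstructed
    (realised⇒¬obstructed (realises-▹ real rs))
  ... | inj₁ eq∈r = find rs eq∈r
    where
    find : ∀ {m} {ys : Vec (V G) m} {r : Vec Kind m} → Pointwise (R w) ys r → Any (eq ≡_) r →
      ∃[ i ] lookup ys i ≡ w
    find (same w≡y ∷ _) (Any.here refl) = zero , sym w≡y
    find (_ ∷ rs)       (Any.there p)   = let i , xi≡w = find rs p in suc i , xi≡w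

  sun⇒≅A₆ : ∀ {xs} → Realises G sun xs → G ≅ A₆
  sun⇒≅A₆ real = labels⇒≅ (labels A₆-sun) sun-vertices-surjective (labels real)
    (saturated⇒surjective sun sun-extensions real)

  -- The dual of the table `net` labels both `complement G` and, read along `net⇒sun`, the graph
  -- `A₆`.
  net⇒complement≅A₆ : ∀ {xs} → Realises G net xs → complement G ≅ A₆
  net⇒complement≅A₆ real = labels⇒≅ {κ = λ i j → dual (kind net i j)}
    (λ i j → subst (Related A₆ _ _) (net-dual i j) (labels A₆-sun (net⇒sun i) (net⇒sun j)))
    (λ x → let j , xj = sun-vertices-surjective x ; i , ij = net⇒sun-surjective j in
      i , trans (cong (lookup sun-vertices) ij) xj)
    {G = complement G}
    (λ i j → related-complement (labels real i j))
    (saturated⇒surjective net net-extensions real)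

  -- Adding w and then x to the bull gives a realised table with seven entries in which only the
  -- kind between x and w is not yet known; `grid-extensions` determines it.
  grid-positions⇒↪ : ∀ {xs} → Realises G bull xs →
    (∀ w → ∃[ p ] Pointwise (R w) xs (grid-row p)) → G ↪ P₉
  grid-positions⇒↪ {xs} real position = grid ∘ proj₁ ∘ position , pres
    where
    related : ∀ x w → R x w (grid-kind (proj₁ (position x)) (proj₁ (position w)))
    related x w = let k , xw = tri x w ; p , ws = position w ; q , ys = position x in
      [ (λ k≡ → subst (R x w) k≡ xw)
      , (λ obstructed → contradiction obstructed
          (realised⇒¬obstructed (realises-▹ 
            (realises-▹ real ws) (xw ∷ ys))))
      ]′ (grid-extensions p q k)

    pres : ∀ {x y k} → R x y k → Related P₉ _ _ k
    pres {x} {y} xy = subst (Related P₉ _ _) (related-unique (related x y) xy)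
      (grid-labels (proj₁ (position x)) (proj₁ (position y)))

  bull⇒listed : ExcludedMiddle (v ⊔ e) → Bull → Listed G ⊎ Listed (complement G)
  bull⇒listed em (xs , real) with em {∃[ w ] Pointwise (R w) xs sun-row}
  ... | yes (w , ws) = inj₁ (inj₁ (sun⇒≅A₆ (realises-▹ real ws)))
  ... | no noSun with em {∃[ w ] Pointwise (R w) xs net-row}
  ...   | yes (w , ws) = inj₂ (inj₁ (net⇒complement≅A₆ (realises-▹ real ws)))
  ...   | no noNet = inj₁ (inj₂ (inj₁ (↪⇒≤ᵢ {F = G} {G = P₉} (lower-em v {e} em) tri
    (grid-positions⇒↪ real position))))
    where
    position : ∀ w → ∃[ p ] Pointwise (R w) xs (grid-row p)
    position w with r , ws ← row tri w xs with bull-extensions r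
    ... | inj₁ obstructed = contradiction obstructed
      (realised⇒¬obstructed (realises-▹ real ws))
    ... | inj₂ (inj₁ refl)              = contradiction (w , ws) noSun
    ... | inj₂ (inj₂ (inj₁ refl))       = contradiction (w , ws) noNet
    ... | inj₂ (inj₂ (inj₂ (p , refl))) = p , ws

clean⇒listed : ExcludedMiddle (v ⊔ e) → (G : Graph v e) → Clean G →
  Listed G ⊎ Listed (complement G)
clean⇒listed {v} {e} em G clean with em {Triangle G} | em {Triangle (complement G)}
... | no noTriangle | _ = inj₁ (inj₂ (inj₂ (triangle-free⇒cycles-and-paths em G noTriangle clean)))
... | yes _ | no noTriangle = inj₂ (inj₂ (inj₂ (triangle-free⇒cycles-and-paths em (complement G)
  noTriangle (clean-complement (em⇒trichotomous em G) clean))))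
... | yes (_ , _ , _ , pq , qr , pr) | yes (_ , _ , _ , (x≢y , x≁y) , (y≢z , y≁z) , (x≢z , x≁z)) =
  bull⇒listed tri clean em (triangle∧independent⇒bull tri clean (edge pq) (edge pr) (edge qr)
    (gap x≢y x≁y) (gap x≢z x≁z) (gap y≢z y≁z))
  where
  tri : Trichotomous G
  tri = em⇒trichotomous em G

theorem1p1 : {v e : Level} → ExcludedMiddle (v ⊔ e) → (G : Graph v e) →
    G ∈ Forb (｛ K₁,₃ ｝ ∪ ｛ complement K₁,₃ ｝) ⇔ (Listed G ⊎ Listed (complement G))
theorem1p1 em G = mk⇔
  (clean⇒listed em G ∘ Equivalence.to forbidden⇔)
  (Equivalence.from forbidden⇔ ∘ [ listed⇒clean , clean-complement⁻¹ ∘ listed⇒clean ]′)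
  where
  forbidden⇔ : Forbidden G ⇔ Clean G
  forbidden⇔ = forbidden⇔clean em G
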